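{- Strong Vacuity is a theorem of $\mathsf{HPAL}$: for all $\varphi,\chi\in\mathcal{L}^{\div}$, the formula $$\bigwedge_{a\in Ag}\forall\neg B_a\varphi\to(\chi\leftrightarrow[\div\varphi]\chi)$$ is a theorem of $\mathsf{HPAL}$.
   Context: Language. $At$ is a countable set of atoms, $Ag$ a finite set of agents. The contraction language $\mathcal{L}^{\div}$ is given by $\varphi::=\top\mid p\mid\neg\varphi\mid\varphi\wedge\varphi\mid B_a\varphi\mid[\div\varphi]\varphi\mid\forall\varphi$ with $p\in At$, $a\in Ag$; the other Boolean connectives are the usual abbreviations. Semantics. A Kripke model is $\mathcal{M}=(W,R,V)$ with $W\neq\emptyset$, $R_a\subseteq W\times W$ an arbitrary relation for each $a\in Ag$, $V:At\to\wp(W)$; $R_a(w)=\{v:(w,v)\in R_a\}$. Atoms and Booleans are standard; $\mathcal{M},w\vDash B_a\varphi$ iff $\mathcal{M},v\vDash\varphi$ for all $v\in R_a(w)$; $\mathcal{M},w\vDash\forall\varphi$ iff $\mathcal{M},v\vDash\varphi$ for all $v\in W$; $\mathcal{M},w\vDash[\div\varphi]\psi$ iff $\mathcal{M}^{\div\varphi},w\vDash\psi$, where $\mathcal{M}^{\div\varphi}=(W,R^{\div\varphi},V)$ with $R_a^{\div\varphi}(w)=R_a(w)\cup\{v\in W:\mathcal{M},v\vDash\neg\varphi\}$ if $\mathcal{M},w\vDash B_a\varphi$, and $R_a^{\div\varphi}(w)=R_a(w)$ otherwise. Proof system $\mathsf{HPAL}$. Axioms: (CL) all classical propositional tautologies;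 ($\forall$K) $\forall(\varphi\to\psi)\to(\forall\varphi\to\forall\psi)$; ($\forall$T) $\forall\varphi\to\varphi$; ($\forall$5) $\neg\forall\varphi\to\forall\neg\forall\varphi$; ($\forall$B) $\forall\varphi\to B_a\varphi$; (BK) $B_a(\varphi\to\psi)\to(B_a\varphi\to B_a\psi)$; (A1) $[\div\varphi]p\leftrightarrow p$ for $p\in At$; (A2) $[\div\varphi]\neg\psi\leftrightarrow\neg[\div\varphi]\psi$; (A3) $[\div\varphi](\psi\wedge\chi)\leftrightarrow[\div\varphi]\psi\wedge[\div\varphi]\chi$; (A4) $[\div\varphi]\forall\psi\leftrightarrow\forall[\div\varphi]\psi$; (A5) $[\div\varphi]B_a\psi\leftrightarrow(B_a[\div\varphi]\psi\wedge(B_a\varphi\to\forall(\neg\varphi\to[\div\varphi]\psi)))$. Rules: (MP) modus ponens; (RE) from $\varphi\leftrightarrow\psi$ infer $\chi[\varphi/p]\leftrightarrow\chi[\psi/p]$ (substitution for $p$ everywhere, including inside dynamic modalities); (NEC) from $\varphi$ infer $\forall\varphi$, $B_a\varphi$, and $[\div\psi]\varphi$. $\mathsf{HPAL}$ is sound and complete: a formula is a theorem of $\mathsf{HPAL}$ iff it is true at every world of every Kripke model. -}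

module Defs where

open import Data.Bool.Base as Bool using (Bool; true)
open import Data.Fin.Base using (Fin)
open import Data.List.Base using (foldr; tabulate)
open import Data.Nat.Base using (ℕ)
import Data.Nat.Properties as ℕ
open import Function.Base using (_∘_)
open import Function.Bundles using (_↣_; _↔_; Inverse)
open import Relation.Binary.Definitions using (DecidableEquality)
open import Relation.Binary.PropositionalEquality.Core using (_≡_)
open import Relation.Nullary.Decidable using (yes; no; via-injection)

-- The atoms may be finite or infinite in number, and either sort may be empty.
record Signature : Set₁ where
  field
    Atom      : Set
    Agent     : Set
    countable : Atom ↣ ℕ
    size      : ℕ
    finite    : Fin size ↔ Agent

  _≟_ : DecidableEquality Atom
  _≟_ = via-injection countable ℕ._≟_

module HPAL (𝒮 : Signature) where
  open Signature 𝒮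

  infix  2 ⊢_
  infix  4 _⇔_
  infixr 5 _⇒_
  infixr 6 _∧_
  infixr 8 ¬_ B[_]_ [÷_]_ ∀∀_
  infix  9 _[_/_]

  data Formula : Set where
    ⊤      : Formula
    atom   : Atom → Formula
    ¬_     : Formula → Formula
    _∧_    : Formula → Formula → Formula
    B[_]_  : Agent → Formula → Formula
    [÷_]_  : Formula → Formula → Formula
    ∀∀_    : Formula → Formula

  _⇒_ : Formula → Formula → Formula
  φ ⇒ ψ = ¬ (φ ∧ ¬ ψ)

  _⇔_ : Formula → Formula → Formula
  φ ⇔ ψ = (φ ⇒ ψ) ∧ (ψ ⇒ φ)

  -- Conjoined in the order given by the enumeration of the agents, ending in ⊤.
  ⋀ : (Agent → Formula) → Formula
  ⋀ f = foldr _∧_ ⊤ (tabulate (f ∘ Inverse.to finite))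

  -- χ [ φ / p ] is χ with φ for p, also inside the modalities [÷_].
  _[_/_] : Formula → Formula → Atom → Formula
  ⊤          [ φ / p ] = ⊤
  atom q     [ φ / p ] with q ≟ p
  ... | yes _ = φ
  ... | no  _ = atom q
  (¬ χ)      [ φ / p ] = ¬ (χ [ φ / p ])
  (χ ∧ ξ)    [ φ / p ] = (χ [ φ / p ]) ∧ (ξ [ φ / p ])
  (B[ a ] χ) [ φ / p ] = B[ a ] (χ [ φ / p ])
  ([÷ χ ] ξ) [ φ / p ] = [÷ χ [ φ / p ] ] (ξ [ φ / p ])
  (∀∀ χ)     [ φ / p ] = ∀∀ (χ [ φ / p ])

  -- Truth-functional evaluation: every formula whose outermost operator is not
  -- Boolean is treated as a propositional letter with value given by v.
  eval : (Formula → Bool) → Formula → Bool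
  eval v ⊤       = true
  eval v (¬ φ)   = Bool.not (eval v φ)
  eval v (φ ∧ ψ) = eval v φ Bool.∧ eval v ψ
  eval v φ@(atom _)    = v φ
  eval v φ@(B[ _ ] _)  = v φ
  eval v φ@([÷ _ ] _)  = v φ
  eval v φ@(∀∀ _)      = v φ

  Tautology : Formula → Set
  Tautology φ = ∀ v → eval v φ ≡ true

  data ⊢_ : Formula → Set where
    CL : ∀ {φ} → Tautology φ → ⊢ φ
    ∀K : ∀ φ ψ → ⊢ ∀∀ (φ ⇒ ψ) ⇒ (∀∀ φ ⇒ ∀∀ ψ)
    ∀T : ∀ φ → ⊢ ∀∀ φ ⇒ φ
    ∀5 : ∀ φ → ⊢ ¬ ∀∀ φ ⇒ ∀∀ ¬ ∀∀ φ
    ∀B : ∀ a φ → ⊢ ∀∀ φ ⇒ B[ a ] φ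
    BK : ∀ a φ ψ → ⊢ B[ a ] (φ ⇒ ψ) ⇒ (B[ a ] φ ⇒ B[ a ] ψ)
    A1 : ∀ φ p → ⊢ [÷ φ ] atom p ⇔ atom p
    A2 : ∀ φ ψ → ⊢ [÷ φ ] ¬ ψ ⇔ ¬ [÷ φ ] ψ
    A3 : ∀ φ ψ χ → ⊢ [÷ φ ] (ψ ∧ χ) ⇔ [÷ φ ] ψ ∧ [÷ φ ] χ
    A4 : ∀ φ ψ → ⊢ [÷ φ ] ∀∀ ψ ⇔ ∀∀ [÷ φ ] ψ
    A5 : ∀ φ a ψ → ⊢ [÷ φ ] B[ a ] ψ
                     ⇔ B[ a ] [÷ φ ] ψ ∧ (B[ a ] φ ⇒ ∀∀ (¬ φ ⇒ [÷ φ ] ψ))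
    MP : ∀ {φ ψ} → ⊢ φ ⇒ ψ → ⊢ φ → ⊢ ψ
    RE : ∀ {φ ψ} χ p → ⊢ φ ⇔ ψ → ⊢ χ [ φ / p ] ⇔ χ [ ψ / p ]
    NEC-∀ : ∀ {φ} → ⊢ φ → ⊢ ∀∀ φ
    NEC-B : ∀ {φ} a → ⊢ φ → ⊢ B[ a ] φ
    NEC-÷ : ∀ {φ} ψ → ⊢ φ → ⊢ [÷ ψ ] φ

{-# OPTIONS --safe #-}

-- Let γ be a formula with ⊢ γ ⇒ ∀∀ γ.  Provable equivalence under the
-- hypothesis γ is then a congruence for every static connective.  For γ = ⊤ the
-- reduction axioms therefore rewrite each formula to a static one, and [÷ φ ]_
-- respects ⊤-equivalence because A2 and A3 make it a Boolean homomorphism.  So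
-- it suffices to treat static χ, by induction, for γ = ⋀ (λ a → ∀∀ ¬ B[ a ] φ):
-- such γ persists by S5, and it refutes the antecedent B[ a ] φ in A5, whence
-- [÷ φ ] B[ a ] ψ is equivalent to B[ a ] [÷ φ ] ψ.

module Submission where

open import Defs

open import Data.Bool.Base using (true; false)
open import Data.Fin.Base using (Fin; zero; suc)
open import Data.List.Base using (foldr; tabulate)
open import Data.Nat.Base using (ℕ; zero; suc)
open import Data.Product.Base using (∃-syntax; _×_; _,_)
open import Function.Base using (_∘_)
open import Function.Bundles using (Inverse)
open import Level using (0ℓ)
open import Relation.Binary.Bundles using (Setoid)
open import Relation.Binary.PropositionalEquality.Core using (refl; subst)
import Relation.Binary.Reasoning.Setoid as SetoidReasoning

module Derivations (𝒮 : Signature) where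
  open Signature 𝒮
  open HPAL 𝒮

  infix 2 _⊩_

  -- The calculus derives theorems only, so a local context is encoded as one formula in antecedent
  -- position; further hypotheses are conjoined to it on the right.
  _⊩_ : Formula → Formula → Set
  γ ⊩ φ = ⊢ γ ⇒ φ

  private
    variable
      γ φ φ′ ψ ψ′ χ : Formula

  -- Propositional tautologies, by truth tables.

  ⇒-const-tautology : ∀ φ ψ → Tautology (φ ⇒ ψ ⇒ φ)
  ⇒-const-tautology φ ψ v with eval v φ | eval v ψ
  ... | false | _     = refl
  ... | true  | false = refl
  ... | true  | true  = refl

  ⇒-distrib-tautology : ∀ φ ψ χ → Tautology ((φ ⇒ ψ ⇒ χ) ⇒ (φ ⇒ ψ) ⇒ φ ⇒ χ)
  ⇒-distrib-tautology φ ψ χ v with eval v φ | eval v ψ | eval v χ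
  ... | false | _     | _     = refl
  ... | true  | false | _     = refl
  ... | true  | true  | false = refl
  ... | true  | true  | true  = refl

  uncurried-tautology : ∀ φ ψ χ → Tautology ((φ ∧ ψ ⇒ χ) ⇒ φ ⇒ ψ ⇒ χ)
  uncurried-tautology φ ψ χ v with eval v φ | eval v ψ | eval v χ
  ... | false | false | _     = refl
  ... | false | true  | _     = refl
  ... | true  | false | _     = refl
  ... | true  | true  | false = refl
  ... | true  | true  | true  = refl

  ∧-proj₁-tautology : ∀ φ ψ → Tautology (φ ∧ ψ ⇒ φ)
  ∧-proj₁-tautology φ ψ v with eval v φ | eval v ψ
  ... | false | _     = refl
  ... | true  | false = refl
  ... | true  | true  = refl

  ∧-proj₂-tautology : ∀ φ ψ → Tautology (φ ∧ ψ ⇒ ψ)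
  ∧-proj₂-tautology φ ψ v with eval v φ | eval v ψ
  ... | false | _     = refl
  ... | true  | false = refl
  ... | true  | true  = refl

  ∧-pair-tautology : ∀ φ ψ → Tautology (φ ⇒ ψ ⇒ φ ∧ ψ)
  ∧-pair-tautology φ ψ v with eval v φ | eval v ψ
  ... | false | _     = refl
  ... | true  | false = refl
  ... | true  | true  = refl

  contraposition-tautology : ∀ φ ψ → Tautology ((φ ⇒ ψ) ⇒ ¬ ψ ⇒ ¬ φ)
  contraposition-tautology φ ψ v with eval v φ | eval v ψ
  ... | false | false = refl
  ... | false | true  = refl
  ... | true  | false = refl
  ... | true  | true  = refl

  ¬¬-elim-tautology : ∀ φ → Tautology (¬ ¬ φ ⇒ φ)
  ¬¬-elim-tautology φ v with eval v φ
  ... | false = refl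
  ... | true  = refl

  ¬¬-intro-tautology : ∀ φ → Tautology (φ ⇒ ¬ ¬ φ)
  ¬¬-intro-tautology φ v with eval v φ
  ... | false = refl
  ... | true  = refl

  explosion-tautology : ∀ φ ψ → Tautology (¬ φ ⇒ φ ⇒ ψ)
  explosion-tautology φ ψ v with eval v φ
  ... | false = refl
  ... | true  = refl

  -- Natural deduction under a hypothesis.

  theorem : ⊢ φ → γ ⊩ φ
  theorem {φ} {γ} = MP (CL (⇒-const-tautology φ γ))

  ⇒-elim : γ ⊩ φ ⇒ ψ → γ ⊩ φ → γ ⊩ ψ
  ⇒-elim {γ} {φ} {ψ} p = MP (MP (CL (⇒-distrib-tautology γ φ ψ)) p)

  apply : ⊢ φ ⇒ ψ → γ ⊩ φ → γ ⊩ ψ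
  apply p = ⇒-elim (theorem p)

  -- With the context inside the formula, the deduction theorem is mere uncurrying and needs no
  -- induction on derivations.
  ⇒-intro : γ ∧ φ ⊩ ψ → γ ⊩ φ ⇒ ψ
  ⇒-intro {γ} {φ} {ψ} = MP (CL (uncurried-tautology γ φ ψ))

  weaken : γ ⊩ ψ → γ ∧ φ ⊩ ψ
  weaken {γ} {φ = φ} p = apply p (CL (∧-proj₁-tautology γ φ))

  hypothesis : γ ∧ φ ⊩ φ
  hypothesis {γ} {φ} = CL (∧-proj₂-tautology γ φ)

  ∧-intro : γ ⊩ φ → γ ⊩ ψ → γ ⊩ φ ∧ ψ
  ∧-intro {φ = φ} {ψ = ψ} p = ⇒-elim (apply (CL (∧-pair-tautology φ ψ)) p)

  ∧-elim₁ : γ ⊩ φ ∧ ψ → γ ⊩ φ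
  ∧-elim₁ {φ = φ} {ψ = ψ} = apply (CL (∧-proj₁-tautology φ ψ))

  ∧-elim₂ : γ ⊩ φ ∧ ψ → γ ⊩ ψ
  ∧-elim₂ {φ = φ} {ψ = ψ} = apply (CL (∧-proj₂-tautology φ ψ))

  contraposition : γ ⊩ φ ⇒ ψ → γ ⊩ ¬ ψ ⇒ ¬ φ
  contraposition {φ = φ} {ψ = ψ} = apply (CL (contraposition-tautology φ ψ))

  ¬¬-elim : γ ⊩ ¬ ¬ φ → γ ⊩ φ
  ¬¬-elim {φ = φ} = apply (CL (¬¬-elim-tautology φ))

  ¬¬-intro : γ ⊩ φ → γ ⊩ ¬ ¬ φ
  ¬¬-intro {φ = φ} = apply (CL (¬¬-intro-tautology φ))

  explosion : γ ⊩ ¬ φ → γ ⊩ φ ⇒ ψ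
  explosion {φ = φ} {ψ = ψ} = apply (CL (explosion-tautology φ ψ))

  ⊢⊤ : ⊢ ⊤
  ⊢⊤ = CL (λ _ → refl)

  discharge-⊤ : ⊤ ⊩ φ → ⊢ φ
  discharge-⊤ p = MP p ⊢⊤

  ⇒-refl : ⊢ φ ⇒ φ
  ⇒-refl = discharge-⊤ (⇒-intro hypothesis)

  ⇒-trans : γ ⊩ φ ⇒ ψ → γ ⊩ ψ ⇒ χ → γ ⊩ φ ⇒ χ
  ⇒-trans p q = ⇒-intro (⇒-elim (weaken q) (⇒-elim (weaken p) hypothesis))

  -- Provable equivalence and the Boolean connectives.

  ⇔-refl : γ ⊩ φ ⇔ φ
  ⇔-refl = ∧-intro (theorem ⇒-refl) (theorem ⇒-refl)

  ⇔-sym : γ ⊩ φ ⇔ ψ → γ ⊩ ψ ⇔ φ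
  ⇔-sym p = ∧-intro (∧-elim₂ p) (∧-elim₁ p)

  ⇔-trans : γ ⊩ φ ⇔ ψ → γ ⊩ ψ ⇔ χ → γ ⊩ φ ⇔ χ
  ⇔-trans p q = ∧-intro (⇒-trans (∧-elim₁ p) (∧-elim₁ q))
                        (⇒-trans (∧-elim₂ q) (∧-elim₂ p))

  ⇔-setoid : Formula → Setoid 0ℓ 0ℓ
  ⇔-setoid γ = record
    { Carrier       = Formula
    ; _≈_           = λ φ ψ → γ ⊩ φ ⇔ ψ
    ; isEquivalence = record { refl = ⇔-refl ; sym = ⇔-sym ; trans = ⇔-trans }
    }

  module ⇔-Reasoning (γ : Formula) = SetoidReasoning (⇔-setoid γ)

  ¬-cong : γ ⊩ φ ⇔ ψ → γ ⊩ ¬ φ ⇔ ¬ ψ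
  ¬-cong p = ∧-intro (contraposition (∧-elim₂ p)) (contraposition (∧-elim₁ p))

  ∧-mono : γ ⊩ φ ⇒ φ′ → γ ⊩ ψ ⇒ ψ′ → γ ⊩ φ ∧ ψ ⇒ φ′ ∧ ψ′
  ∧-mono p q = ⇒-intro (∧-intro (⇒-elim (weaken p) (∧-elim₁ hypothesis))
                                (⇒-elim (weaken q) (∧-elim₂ hypothesis)))

  ∧-cong : γ ⊩ φ ⇔ φ′ → γ ⊩ ψ ⇔ ψ′ → γ ⊩ φ ∧ ψ ⇔ φ′ ∧ ψ′
  ∧-cong p q = ∧-intro (∧-mono (∧-elim₁ p) (∧-elim₁ q))
                       (∧-mono (∧-elim₂ p) (∧-elim₂ q))

  ⇒-cong : γ ⊩ φ ⇔ φ′ → γ ⊩ ψ ⇔ ψ′ → γ ⊩ (φ ⇒ ψ) ⇔ (φ′ ⇒ ψ′)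
  ⇒-cong p q = ¬-cong (∧-cong p (¬-cong q))

  ∧-identityʳ : γ ⊩ ψ → γ ⊩ φ ∧ ψ ⇔ φ
  ∧-identityʳ p = ∧-intro (⇒-intro (∧-elim₁ hypothesis))
                          (⇒-intro (∧-intro hypothesis (weaken p)))

  -- Persistent hypotheses and the static modalities.

  Persistent : Formula → Set
  Persistent γ = γ ⊩ ∀∀ γ

  ∀-mono : ⊢ φ ⇒ ψ → ⊢ ∀∀ φ ⇒ ∀∀ ψ
  ∀-mono {φ} {ψ} p = MP (∀K φ ψ) (NEC-∀ p)

  -- Necessitation applies to theorems only: it turns `γ ⇒ φ` into `∀∀ γ ⇒ ∀∀ φ`, and persistence
  -- supplies `∀∀ γ` from `γ`.
  ∀-intro : Persistent γ → γ ⊩ φ → γ ⊩ ∀∀ φ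
  ∀-intro persists p = apply (∀-mono p) persists

  ∀-cong : Persistent γ → γ ⊩ φ ⇔ ψ → γ ⊩ ∀∀ φ ⇔ ∀∀ ψ
  ∀-cong persists p =
    ∧-intro (apply (∀K _ _) (∀-intro persists (∧-elim₁ p)))
            (apply (∀K _ _) (∀-intro persists (∧-elim₂ p)))

  -- Under a persistent `γ` both implications hold universally, so by `∀B` they are believed, and
  -- `BK` distributes the belief.
  B-cong : ∀ a → Persistent γ → γ ⊩ φ ⇔ ψ → γ ⊩ B[ a ] φ ⇔ B[ a ] ψ
  B-cong a persists p =
    ∧-intro (apply (BK a _ _) (apply (∀B a _) (∀-intro persists (∧-elim₁ p))))
            (apply (BK a _ _) (apply (∀B a _) (∀-intro persists (∧-elim₂ p))))

  ⊤-persistent : Persistent ⊤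
  ⊤-persistent = theorem (NEC-∀ ⊢⊤)

  ∧-persistent : Persistent φ → Persistent ψ → Persistent (φ ∧ ψ)
  ∧-persistent {φ} {ψ} p q =
    ⇒-elim (apply (∀K _ _) (apply (∀-mono (CL (∧-pair-tautology φ ψ))) (weaken p)))
           (apply q hypothesis)

  -- Axiom 4 of S5: ∀∀ φ yields ¬ ∀∀ ¬ ∀∀ φ by ∀T, hence ∀∀ ¬ ∀∀ ¬ ∀∀ φ by ∀5,
  -- and ¬ ∀∀ ¬ ∀∀ φ gives back ∀∀ φ by ∀5.
  ∀-persistent : ∀ φ → Persistent (∀∀ φ)
  ∀-persistent φ = apply (∀-mono recover) (apply (∀5 (¬ ∀∀ φ)) possible)
    where
    possible : ∀∀ φ ⊩ ¬ ∀∀ ¬ ∀∀ φ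
    possible = apply (discharge-⊤ (contraposition (theorem (∀T (¬ ∀∀ φ)))))
                     (¬¬-intro ⇒-refl)

    recover : ¬ ∀∀ ¬ ∀∀ φ ⊩ ∀∀ φ
    recover = ¬¬-elim (discharge-⊤ (contraposition (theorem (∀5 φ))))

  -- Conjunctions over the agents.

  conjunction-persistent : ∀ {n} (f : Fin n → Formula) → (∀ i → Persistent (f i)) →
                           Persistent (foldr _∧_ ⊤ (tabulate f))
  conjunction-persistent {zero}  f p = ⊤-persistent
  conjunction-persistent {suc n} f p =
    ∧-persistent (p zero) (conjunction-persistent (f ∘ suc) (p ∘ suc))

  conjunction-elim : ∀ {n} (f : Fin n → Formula) i → foldr _∧_ ⊤ (tabulate f) ⊩ f i
  conjunction-elim f zero    = weaken ⇒-refl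
  conjunction-elim f (suc i) = apply (conjunction-elim (f ∘ suc) i) hypothesis

  ⋀-persistent : ∀ f → (∀ a → Persistent (f a)) → Persistent (⋀ f)
  ⋀-persistent f p =
    conjunction-persistent (f ∘ Inverse.to finite) (p ∘ Inverse.to finite)

  ⋀-elim : ∀ f a → ⋀ f ⊩ f a
  ⋀-elim f a = subst (λ b → ⋀ f ⊩ f b) (Inverse.strictlyInverseˡ finite a)
    (conjunction-elim (f ∘ Inverse.to finite) (Inverse.from finite a))

  -- The contraction modality on Boolean structure.

  ÷-⊤ : γ ⊩ [÷ φ ] ⊤ ⇔ ⊤
  ÷-⊤ {φ = φ} =
    ∧-intro (⇒-intro (theorem ⊢⊤)) (⇒-intro (theorem (NEC-÷ φ ⊢⊤)))

  ÷-⇒ : γ ⊩ [÷ φ ] (ψ ⇒ χ) ⇔ ([÷ φ ] ψ ⇒ [÷ φ ] χ)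
  ÷-⇒ {γ} {φ} {ψ} {χ} = begin
    [÷ φ ] (ψ ⇒ χ)                ≈⟨ theorem (A2 φ (ψ ∧ ¬ χ)) ⟩
    ¬ [÷ φ ] (ψ ∧ ¬ χ)            ≈⟨ ¬-cong (theorem (A3 φ ψ (¬ χ))) ⟩
    ¬ ([÷ φ ] ψ ∧ [÷ φ ] ¬ χ)     ≈⟨ ¬-cong (∧-cong ⇔-refl (theorem (A2 φ χ))) ⟩
    ([÷ φ ] ψ ⇒ [÷ φ ] χ)         ∎
    where open ⇔-Reasoning γ

  ÷-mono : ⊢ ψ ⇒ χ → γ ⊩ [÷ φ ] ψ ⇒ [÷ φ ] χ
  ÷-mono {φ = φ} p = ⇒-elim (∧-elim₁ ÷-⇒) (theorem (NEC-÷ φ p))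

  -- The premise is stated under `⊤` because an equivalence that depends on `γ` need not survive
  -- contraction: `γ` may fail in the contracted model.
  ÷-cong : ⊤ ⊩ ψ ⇔ χ → γ ⊩ [÷ φ ] ψ ⇔ [÷ φ ] χ
  ÷-cong p = ∧-intro (÷-mono (discharge-⊤ (∧-elim₁ p)))
                     (÷-mono (discharge-⊤ (∧-elim₂ p)))

  -- Reduction to static formulas.

  data Static : Formula → Set where
    ⊤      : Static ⊤
    atom   : ∀ p → Static (atom p)
    ¬_     : Static φ → Static (¬ φ)
    _∧_    : Static φ → Static ψ → Static (φ ∧ ψ)
    B[_]_  : ∀ a → Static φ → Static (B[ a ] φ)
    ∀∀_    : Static φ → Static (∀∀ φ)

  StaticallyExpressible : Formula → Set
  StaticallyExpressible φ = ∃[ φ′ ] Static φ′ × (⊤ ⊩ φ ⇔ φ′)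

  -- The reduction axioms push `[÷ φ ]_` inward until A1 or `÷-⊤` removes it. Only A5 releases `φ`
  -- from the modality, and there its static equivalent takes its place.
  ÷-static : StaticallyExpressible φ → Static ψ → StaticallyExpressible ([÷ φ ] ψ)
  ÷-static e ⊤ = ⊤ , ⊤ , ÷-⊤
  ÷-static {φ} e (atom p) = atom p , atom p , theorem (A1 φ p)
  ÷-static {φ} e (¬ s) with ÷-static e s
  ... | τ , t , p = ¬ τ , ¬ t , ⇔-trans (theorem (A2 φ _)) (¬-cong p)
  ÷-static {φ} e (s ∧ s′) with ÷-static e s | ÷-static e s′
  ... | τ , t , p | τ′ , t′ , p′ =
    τ ∧ τ′ , t ∧ t′ , ⇔-trans (theorem (A3 φ _ _)) (∧-cong p p′)
  ÷-static {φ} e@(φ′ , f , q) (B[ a ] s) with ÷-static e s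
  ... | τ , t , p =
    B[ a ] τ ∧ (B[ a ] φ′ ⇒ ∀∀ (¬ φ′ ⇒ τ)) ,
    -- This follows the witness above with each `⇒` unfolded into `¬` and `∧`.
    (B[ a ] t) ∧ (¬ ((B[ a ] f) ∧ (¬ (∀∀ (¬ ((¬ f) ∧ (¬ t))))))) ,
    ⇔-trans (theorem (A5 φ a _))
      (∧-cong (B-cong a ⊤-persistent p)
              (⇒-cong (B-cong a ⊤-persistent q)
                      (∀-cong ⊤-persistent (⇒-cong (¬-cong q) p))))
  ÷-static {φ} e (∀∀ s) with ÷-static e s
  ... | τ , t , p =
    ∀∀ τ , ∀∀ t , ⇔-trans (theorem (A4 φ _)) (∀-cong ⊤-persistent p)

  staticallyExpressible : ∀ φ → StaticallyExpressible φ
  staticallyExpressible ⊤        = ⊤ , ⊤ , ⇔-refl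
  staticallyExpressible (atom p) = atom p , atom p , ⇔-refl
  staticallyExpressible (¬ φ) with staticallyExpressible φ
  ... | φ′ , s , p = ¬ φ′ , ¬ s , ¬-cong p
  staticallyExpressible (φ ∧ ψ) with staticallyExpressible φ | staticallyExpressible ψ
  ... | φ′ , s , p | ψ′ , t , q = φ′ ∧ ψ′ , s ∧ t , ∧-cong p q
  staticallyExpressible (B[ a ] φ) with staticallyExpressible φ
  ... | φ′ , s , p = B[ a ] φ′ , B[ a ] s , B-cong a ⊤-persistent p
  staticallyExpressible ([÷ φ ] ψ) with staticallyExpressible ψ
  -- Innermost first: the body is static before the outer modality is pushed through it.
  ... | ψ′ , t , q with ÷-static (staticallyExpressible φ) t
  ...   | τ , u , p = τ , u , ⇔-trans (÷-cong q) p
  staticallyExpressible (∀∀ φ) with staticallyExpressible φ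
  ... | φ′ , s , p = ∀∀ φ′ , ∀∀ s , ∀-cong ⊤-persistent p

  -- Vacuity under a persistent hypothesis.

  static-vacuity : Persistent γ → (∀ a → γ ⊩ ¬ B[ a ] φ) →
                   Static χ → γ ⊩ χ ⇔ [÷ φ ] χ
  static-vacuity {γ} {φ} persists disbelief = vacuous
    where
    -- Staticity leaves no case of a nested contraction, through which an equivalence under `γ`
    -- could not be carried.
    vacuous : Static χ → γ ⊩ χ ⇔ [÷ φ ] χ
    vacuous ⊤          = ⇔-sym ÷-⊤
    vacuous (atom p)   = ⇔-sym (theorem (A1 φ p))
    vacuous (¬ s)      = ⇔-trans (¬-cong (vacuous s)) (⇔-sym (theorem (A2 φ _)))
    vacuous (s ∧ t)    =
      ⇔-trans (∧-cong (vacuous s) (vacuous t)) (⇔-sym (theorem (A3 φ _ _)))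
    vacuous (B[ a ] s) =
      ⇔-trans (B-cong a persists (vacuous s))
        (⇔-sym (⇔-trans (theorem (A5 φ a _)) (∧-identityʳ (explosion (disbelief a)))))
    vacuous (∀∀ s)     =
      ⇔-trans (∀-cong persists (vacuous s)) (⇔-sym (theorem (A4 φ _)))

  vacuity : Persistent γ → (∀ a → γ ⊩ ¬ B[ a ] φ) → ∀ χ → γ ⊩ χ ⇔ [÷ φ ] χ
  vacuity {γ} {φ} persists disbelief χ with staticallyExpressible χ
  ... | χ′ , s , p = begin
    χ          ≈⟨ theorem (discharge-⊤ p) ⟩
    χ′         ≈⟨ static-vacuity persists disbelief s ⟩
    -- Replacement below `[÷ φ ]_` is sound here since `p` is an equivalence under `⊤`.
    [÷ φ ] χ′  ≈⟨ ÷-cong p ⟨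
    [÷ φ ] χ   ∎
    where open ⇔-Reasoning γ

proposition6p4 : (𝒮 : Signature) → let open HPAL 𝒮 in
    (φ χ : Formula) → ⊢ ⋀ (λ a → ∀∀ ¬ B[ a ] φ) ⇒ (χ ⇔ [÷ φ ] χ)
proposition6p4 𝒮 φ =
  vacuity (⋀-persistent _ (λ a → ∀-persistent (¬ B[ a ] φ)))
          (λ a → apply (∀T _) (⋀-elim (λ a → ∀∀ ¬ B[ a ] φ) a))
  where
  open HPAL 𝒮
  open Derivations 𝒮
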